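{- Let $\{\xi_{pq}:\mathbf A_p\Rightarrow\mathbf A_q: p\preceq q\text{ in }\mathbf I\}$ be a semilattice directed system of metamorphisms of algebras of type $\tau$ (with $\mathbf I$ having a least element if $\tau$ has constants) and let $\mathbf A$ be its Płonka sum. For each $n$-ary symbol $\sigma$ and $0\le i\le n$ define $a\odot^\sigma_i b:=\xi^{\sigma i}_{ps}(a)$ for $a\in A_p$, $b\in A_q$, $s:=p\vee q$. Then $\sigma\mapsto\langle\odot^\sigma_0,\dots,\odot^\sigma_n\rangle$ is a partition system for $\mathbf A$; the classes of the common equivalence $\equiv_\odot$ are exactly the sets $A_p$, with $a\preceq_\odot b$ iff $p\preceq q$ for $a\in A_p,b\in A_q$; and the directed system induced by this partition system (via $\xi'^{\sigma i}_{pq}(a)=a\odot^\sigma_i b$ for any $b\in A_q$) coincides with the given one, i.e. $a\odot^\sigma_i b=\xi^{\sigma i}_{pq}(a)$ for $p\preceq q$, $a\in A_p$, $b\in A_q$.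
   Context: A left normal band on a set $A$ is a binary operation $\odot$ with $a\odot a=a$, $a\odot(b\odot c)=(a\odot b)\odot c$, $a\odot(b\odot c)=a\odot(c\odot b)$. Put $a\preceq_\odot b\iff b\odot a=b$, and $a\equiv_\odot b$ iff $a\preceq_\odot b$ and $b\preceq_\odot a$. Left normal bands $\odot,\otimes$ are homotactic if $\preceq_\odot=\preceq_\otimes$. For an algebra $\mathbf A$ of type $\tau$, a partition system assigns to each $n$-ary symbol $\sigma$ (constants: $n=0$) a tuple $\langle\odot^\sigma_0,\dots,\odot^\sigma_n\rangle$ of pairwise homotactic left normal bands (homotactic across all $\sigma$) such that for all $a_i,b$: if $n\ge1$, $\sigma^{\mathbf A}(a_1,\dots,a_n)\odot^\sigma_0b=\sigma^{\mathbf A}(a_1\odot^\sigma_1b,\dots,a_n\odot^\sigma_nb)$; and $b\odot^\sigma_0\sigma^{\mathbf A}(a_1,\dots,a_n)=b\odot^\sigma_0a_1\odot^\sigma_0\cdots\odot^\sigma_0a_n$ (for constants $\omega$: $b\odot^\omega_0\omega^{\mathbf A}=b$). A metamorphism $f:\mathbf A\Rightarrow\mathbf B$ assigns to each $n$-ary $\sigma$ maps $f^{\sigma0},\dots,f^{\sigma n}:A\to B$ with $f^{\sigma0}(\sigma^{\mathbf A}(a_1,\dots,a_n))=\sigma^{\mathbf B}(f^{\sigma1}(a_1),\dots,f^{\sigma n}(a_n))$; composition is componentwise. A semilattice directed system of metamorphisms over a join-semilattice $\mathbf I=\langle I,\vee\rangle$ (order $\preceq$) is a family of pairwise disjoint algebras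 $\mathbf A_p$ with metamorphisms $\xi_{pq}:\mathbf A_p\Rightarrow\mathbf A_q$ ($p\preceq q$), $\xi_{pp}$ identity, $\xi_{qr}\circ\xi_{pq}=\xi_{pr}$. Its Płonka sum is the algebra on $\biguplus_pA_p$ with $\sigma(a_1,\dots,a_n):=\sigma^{\mathbf A_q}(\xi^{\sigma1}_{p_1q}(a_1),\dots,\xi^{\sigma n}_{p_nq}(a_n))$ for $a_i\in A_{p_i}$, $q=p_1\vee\dots\vee p_n$, and $\omega:=\omega^{\mathbf A_\bot}$ for constants, $\bot$ the least element of $\mathbf I$. -}

module Defs where

open import Algebra.Core using (Op₂)
open import Algebra.Structures using (IsBand)
open import Data.Fin.Base using (Fin; zero; suc)
open import Data.Nat.Base using (ℕ; suc; _>_)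
open import Data.Product.Base using (Σ; ∃; _×_; _,_; proj₁; proj₂)
open import Data.Vec.Base using (Vec; []; _∷_; lookup; map; tabulate; foldl′; foldr₁)
open import Data.Vec.Properties using (lookup∘tabulate; tabulate-cong; tabulate∘lookup; lookup-map)
open import Function.Bundles using (_⇔_)
open import Level using (Level; _⊔_) renaming (suc to lsuc)
open import Relation.Binary.Core using (Rel)
open import Relation.Binary.Definitions using (Minimum)
open import Relation.Binary.Lattice.Structures using (IsJoinSemilattice)
open import Relation.Binary.PropositionalEquality.Core
  using (_≡_; refl; sym; trans; cong)
open import Relation.Unary using (Pred; Satisfiable; _≐_)

private variable
  o a b c i ℓ ℓ₁ ℓ₂ : Level

record Signature (o : Level) : Set (lsuc o) where
  field
    Op    : Set o
    arity : Op → ℕ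

open Signature public

HasConstants : Signature o → Set o
HasConstants τ = ∃ λ (σ : Op τ) → arity τ σ ≡ 0

record Algebra (τ : Signature o) (a : Level) : Set (o ⊔ lsuc a) where
  field
    Carrier : Set a
    ⟦_⟧     : (σ : Op τ) → Vec Carrier (arity τ σ) → Carrier

open Algebra public using (Carrier)

record IsLeftNormalBand {A : Set a} (_⊙_ : Op₂ A) : Set a where
  field
    isBand     : IsBand _≡_ _⊙_
    leftNormal : ∀ x y z → (x ⊙ (y ⊙ z)) ≡ (x ⊙ (z ⊙ y))

  open IsBand isBand public

Preorder : {A : Set a} → Op₂ A → Rel A a
Preorder _⊙_ x y = (y ⊙ x) ≡ y

Equiv : {A : Set a} → Op₂ A → Rel A a
Equiv _⊙_ x y = Preorder _⊙_ x y × Preorder _⊙_ y x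

Homotactic : {A : Set a} → Op₂ A → Op₂ A → Set a
Homotactic _⊙_ _⊗_ = ∀ x y → Preorder _⊙_ x y ⇔ Preorder _⊗_ x y

-- For an n-ary σ, the index zero is the output coordinate and suc k is
-- the coordinate of the k-th argument (arguments are counted from 0).
Coord : (τ : Signature o) → Op τ → Set
Coord τ σ = Fin (suc (arity τ σ))

record IsPartitionSystem {τ : Signature o} (𝐀 : Algebra τ a)
         (⊙ : (σ : Op τ) → Coord τ σ → Op₂ (Carrier 𝐀)) : Set (o ⊔ a) where
  open Algebra 𝐀 using (⟦_⟧)
  field
    isLeftNormalBand : ∀ σ k → IsLeftNormalBand (⊙ σ k)
    homotactic       : ∀ σ k σ′ k′ → Homotactic (⊙ σ k) (⊙ σ′ k′)
    distrib          : ∀ σ → arity τ σ > 0 → ∀ as b →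
                       ⊙ σ zero (⟦ σ ⟧ as) b
                         ≡ ⟦ σ ⟧ (tabulate λ k → ⊙ σ (suc k) (lookup as k) b)
    -- For a constant the fold is over the empty vector, so the right-hand
    -- side is b.
    absorb           : ∀ σ as b →
                       ⊙ σ zero b (⟦ σ ⟧ as) ≡ foldl′ (⊙ σ zero) b as

record Metamorphism {τ : Signature o} (𝐀 : Algebra τ a) (𝐁 : Algebra τ b)
         : Set (o ⊔ a ⊔ b) where
  private
    module A = Algebra 𝐀
    module B = Algebra 𝐁
  field
    app : (σ : Op τ) → Coord τ σ → A.Carrier → B.Carrier
    hom : ∀ σ as → app σ zero (A.⟦ σ ⟧ as)
                     ≡ B.⟦ σ ⟧ (tabulate λ k → app σ (suc k) (lookup as k))

open Metamorphism public

module _ {τ : Signature o} where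

  infix  4 _≈ᴹ_
  infixr 9 _∘ᴹ_

  _≈ᴹ_ : {𝐀 : Algebra τ a} {𝐁 : Algebra τ b} → Rel (Metamorphism 𝐀 𝐁) (o ⊔ a ⊔ b)
  f ≈ᴹ g = ∀ σ k x → app f σ k x ≡ app g σ k x

  idᴹ : {𝐀 : Algebra τ a} → Metamorphism 𝐀 𝐀
  idᴹ         .app σ k x  = x
  idᴹ {𝐀 = 𝐀} .hom σ as = cong (Algebra.⟦ 𝐀 ⟧ σ) (sym (tabulate∘lookup as))

  _∘ᴹ_ : {𝐀 : Algebra τ a} {𝐁 : Algebra τ b} {𝐂 : Algebra τ c} →
         Metamorphism 𝐁 𝐂 → Metamorphism 𝐀 𝐁 → Metamorphism 𝐀 𝐂
  (g ∘ᴹ f) .app σ k x = app g σ k (app f σ k x)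
  _∘ᴹ_ {𝐂 = 𝐂} g f .hom σ as =
    trans (cong (app g σ zero) (hom f σ as))
      (trans (hom g σ _)
        (cong (Algebra.⟦ 𝐂 ⟧ σ) (tabulate-cong λ k →
          cong (app g σ (suc k)) (lookup∘tabulate _ k))))

module _ {I : Set i} {_≤_ : Rel I ℓ} {_∨_ : Op₂ I}
         (𝐈 : IsJoinSemilattice _≡_ _≤_ _∨_) where

  open IsJoinSemilattice 𝐈
    using (x≤x∨y; y≤x∨y) renaming (refl to ≤-refl; trans to ≤-trans)

  -- Both laws quantify over all proofs of the inequalities involved, so the
  -- metamorphism ξ p≤q depends, up to _≈ᴹ_, only on the pair (p , q).
  record DirectedSystem {τ : Signature o} (𝐀 : I → Algebra τ a)
           : Set (o ⊔ a ⊔ i ⊔ ℓ) where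
    field
      ξ      : ∀ {p q} → p ≤ q → Metamorphism (𝐀 p) (𝐀 q)
      ξ-id   : ∀ {p} (p≤p : p ≤ p) → ξ p≤p ≈ᴹ idᴹ
      ξ-comp : ∀ {p q r} (p≤q : p ≤ q) (q≤r : q ≤ r) (p≤r : p ≤ r) →
               ξ q≤r ∘ᴹ ξ p≤q ≈ᴹ ξ p≤r

  -- The least element serves only as the join of the empty vector.
  ⋁ : ∀ {n} → (n ≡ 0 → ∃ (Minimum _≤_)) → Vec I n → I
  ⋁ bot []       = proj₁ (bot refl)
  ⋁ bot (p ∷ ps) = foldr₁ _∨_ (p ∷ ps)

  lookup≤⋁ : ∀ {n} (bot : n ≡ 0 → ∃ (Minimum _≤_)) (ps : Vec I n) (k : Fin n) →
             lookup ps k ≤ ⋁ bot ps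
  lookup≤⋁ bot (p ∷ ps) = go p ps
    where
    go : ∀ {n} p (ps : Vec I n) k → lookup (p ∷ ps) k ≤ foldr₁ _∨_ (p ∷ ps)
    go p []       zero    = ≤-refl
    go p (q ∷ ps) zero    = x≤x∨y p _
    go p (q ∷ ps) (suc k) = ≤-trans (go q ps k) (y≤x∨y p _)

  module _ {τ : Signature o} {𝐀 : I → Algebra τ a} (D : DirectedSystem 𝐀) where

    open DirectedSystem D

    -- The universes are made disjoint by tagging each element with its index.
    ⨄ : Set (i ⊔ a)
    ⨄ = Σ I λ p → Carrier (𝐀 p)

    Fibre : I → Pred ⨄ i
    Fibre p x = proj₁ x ≡ p

    PłonkaSum : (HasConstants τ → ∃ (Minimum _≤_)) → Algebra τ (i ⊔ a)
    PłonkaSum bot = record { Carrier = ⨄ ; ⟦_⟧ = op }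
      where
      op : (σ : Op τ) → Vec ⨄ (arity τ σ) → ⨄
      op σ xs = q , Algebra.⟦ 𝐀 q ⟧ σ (tabulate λ k →
        app (ξ (index≤q k)) σ (suc k) (proj₂ (lookup xs k)))
        where
        ⊥σ : arity τ σ ≡ 0 → ∃ (Minimum _≤_)
        ⊥σ n≡0 = bot (σ , n≡0)

        q : I
        q = ⋁ ⊥σ (map proj₁ xs)

        index≤q : ∀ k → proj₁ (lookup xs k) ≤ q
        index≤q k = ≤-respˡ (lookup-map k proj₁ xs) (lookup≤⋁ ⊥σ (map proj₁ xs) k)
          where
          ≤-respˡ : ∀ {x y z} → x ≡ y → x ≤ z → y ≤ z
          ≤-respˡ refl x≤z = x≤z

    sumBand : (σ : Op τ) → Coord τ σ → Op₂ ⨄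
    sumBand σ k (p , x) (q , y) = (p ∨ q) , app (ξ (x≤x∨y p q)) σ k x

-- The equivalence classes of _≈_ are exactly the sets F p.  An empty F p is
-- not a class, so the second half ranges over the nonempty ones; when every
-- F p is nonempty this is no restriction.
ClassesAre : {A : Set a} {P : Set i} → Rel A ℓ₁ → (P → Pred A ℓ₂) → Set (a ⊔ i ⊔ ℓ₁ ⊔ ℓ₂)
ClassesAre _≈_ F =
    (∀ x → ∃ λ p → (x ≈_) ≐ F p)
  × (∀ p → Satisfiable (F p) → ∃ λ x → F p ≐ (x ≈_))

{-# OPTIONS --safe #-}

-- Both sides of every identity are of the form (s , ξ x), or (s , ⟦ σ ⟧ of such images), with s
-- a join of indices.  By functoriality ξ x depends only on x and s, so each identity reduces to
-- an equality of joins in the index semilattice.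
module Submission where

open import Defs
open import Algebra.Core using (Op₂)
open import Data.Fin.Base using (zero; suc; fromℕ<)
open import Data.Nat.Base using (_>_)
open import Data.Product.Base using (∃; _×_; _,_; proj₁; proj₂)
open import Data.Vec.Base using (Vec; []; _∷_; lookup; map; tabulate; foldl′; foldr₁)
open import Data.Vec.Properties using (lookup∘tabulate; tabulate-cong; lookup-map)
open import Function.Base using (_∘_)
open import Function.Bundles using (_⇔_; mk⇔; Equivalence)
import Function.Properties.Equivalence as ⇔
open import Level using (Level)
open import Relation.Binary.Core using (Rel)
open import Relation.Binary.Definitions using (Minimum)
open import Relation.Binary.Lattice.Bundles using (JoinSemilattice)
open import Relation.Binary.Lattice.Structures using (IsJoinSemilattice)
import Relation.Binary.Lattice.Properties.JoinSemilattice as JoinSemilatticeProperties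
open import Relation.Binary.PropositionalEquality.Core
  using (_≡_; refl; sym; trans; cong; cong₂; subst)
open import Relation.Binary.PropositionalEquality.Properties using (isEquivalence; module ≡-Reasoning)

private variable
  o i ℓ a : Level

module _ {I : Set i} {_≤_ : Rel I ℓ} {_∨_ : Op₂ I}
         (𝐈 : IsJoinSemilattice _≡_ _≤_ _∨_) where

  open Equivalence using (to; from)
  open IsJoinSemilattice 𝐈
    using (x≤x∨y; y≤x∨y; ∨-least; antisym; reflexive)
    renaming (refl to ≤-refl; trans to ≤-trans)

  joinSemilattice : JoinSemilattice _ _ _
  joinSemilattice = record { isJoinSemilattice = 𝐈 }

  open JoinSemilatticeProperties joinSemilattice
    using (∨-assoc; ∨-comm; x≤y⇒x∨y≈y)

  x≤y⇒y∨x≡y : ∀ {x y} → x ≤ y → (y ∨ x) ≡ y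
  x≤y⇒y∨x≡y x≤y = trans (∨-comm _ _) (x≤y⇒x∨y≈y x≤y)

  x≤foldl′-∨ : ∀ {n} p (ps : Vec I n) → p ≤ foldl′ _∨_ p ps
  x≤foldl′-∨ p []       = ≤-refl
  x≤foldl′-∨ p (q ∷ ps) = ≤-trans (x≤x∨y p q) (x≤foldl′-∨ (p ∨ q) ps)

  ⋁-least : ∀ {n} (bot : n ≡ 0 → ∃ (Minimum _≤_)) (ps : Vec I n) {r} →
            (∀ k → lookup ps k ≤ r) → ⋁ 𝐈 bot ps ≤ r
  ⋁-least bot []       ps≤r = proj₂ (bot refl) _
  ⋁-least bot (p ∷ ps) ps≤r = go p ps ps≤r
    where
    go : ∀ {n} p (ps : Vec I n) {r} → (∀ k → lookup (p ∷ ps) k ≤ r) →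
         foldr₁ _∨_ (p ∷ ps) ≤ r
    go p []       ps≤r = ps≤r zero
    go p (q ∷ ps) ps≤r = ∨-least (ps≤r zero) (go q ps (ps≤r ∘ suc))

  -- Index part of the absorption law: `∨-assoc` turns the right-nested join into the left-nested
  -- fold. For constants it amounts to neutrality of the least element.
  ∨-⋁ : ∀ {n} (bot : n ≡ 0 → ∃ (Minimum _≤_)) q (ps : Vec I n) →
        (q ∨ ⋁ 𝐈 bot ps) ≡ foldl′ _∨_ q ps
  ∨-⋁ bot q []       = x≤y⇒y∨x≡y (proj₂ (bot refl) q)
  ∨-⋁ bot q (p ∷ ps) = go q p ps
    where
    go : ∀ {n} q p (ps : Vec I n) → (q ∨ foldr₁ _∨_ (p ∷ ps)) ≡ foldl′ _∨_ (q ∨ p) ps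
    go q p []        = refl
    go q p (p′ ∷ ps) = trans (sym (∨-assoc q p _)) (go (q ∨ p) p′ ps)

  -- Index part of distributivity. Both sides are least upper bounds of the entries of `ps` together
  -- with `r`; with no entries the right-hand side would be the least element and lose `r`.
  ⋁-∨ : ∀ {n} (bot : n ≡ 0 → ∃ (Minimum _≤_)) (ps qs : Vec I n) r →
        n > 0 → (∀ k → lookup qs k ≡ (lookup ps k ∨ r)) →
        (⋁ 𝐈 bot ps ∨ r) ≡ ⋁ 𝐈 bot qs
  ⋁-∨ bot ps qs r n>0 qs≡ = antisym
    (∨-least (⋁-least bot ps λ k → ≤-trans (x≤x∨y _ r) (ps∨r≤ k))
             -- Any entry of `qs` lies above `r`; position 0 is chosen.
             (≤-trans (y≤x∨y _ r) (ps∨r≤ (fromℕ< n>0))))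
    (⋁-least bot qs λ k → ≤-trans (reflexive (qs≡ k))
      (∨-least (≤-trans (lookup≤⋁ 𝐈 bot ps k) (x≤x∨y _ r)) (y≤x∨y _ r)))
    where
    ps∨r≤ : ∀ k → (lookup ps k ∨ r) ≤ ⋁ 𝐈 bot qs
    ps∨r≤ k = ≤-trans (reflexive (sym (qs≡ k))) (lookup≤⋁ 𝐈 bot qs k)

  module _ {τ : Signature o} {𝐀 : I → Algebra τ a} (D : DirectedSystem 𝐈 𝐀) where

    open DirectedSystem D

    -- `ξ-comp` leaves the proof for the composite free, so `ξ p≤q ∘ᴹ ξ ≤-refl` agrees with both
    -- maps.
    ξ-irrelevant : ∀ {p q} (p≤q p≤q′ : p ≤ q) → ξ p≤q ≈ᴹ ξ p≤q′
    ξ-irrelevant p≤q p≤q′ σ k x =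
      trans (sym (ξ-comp ≤-refl p≤q p≤q σ k x)) (ξ-comp ≤-refl p≤q p≤q′ σ k x)

    -- The images live in different algebras until `s ≡ t` is matched, hence the equation between
    -- pairs.
    ξ-cong : ∀ σ k {p s t} {x : Carrier (𝐀 p)} (p≤s : p ≤ s) (p≤t : p ≤ t) → s ≡ t →
             _≡_ {A = ⨄ 𝐈 D} (s , app (ξ p≤s) σ k x) (t , app (ξ p≤t) σ k x)
    ξ-cong σ k p≤s p≤t refl = cong (_ ,_) (ξ-irrelevant p≤s p≤t σ k _)

    sumBand-image : ∀ σ k ((p , x) (q , y) : ⨄ 𝐈 D) {s} (p≤s : p ≤ s) → (p ∨ q) ≡ s →
                    sumBand 𝐈 D σ k (p , x) (q , y) ≡ (s , app (ξ p≤s) σ k x)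
    sumBand-image σ k (p , x) (q , y) p≤s = ξ-cong σ k (x≤x∨y p q) p≤s

    sumBand-identityʳ : ∀ σ k ((p , x) (q , y) : ⨄ 𝐈 D) → q ≤ p →
                        sumBand 𝐈 D σ k (p , x) (q , y) ≡ (p , x)
    sumBand-identityʳ σ k (p , x) (q , y) q≤p = trans
      (sumBand-image σ k (p , x) (q , y) ≤-refl (x≤y⇒y∨x≡y q≤p))
      (cong (p ,_) (ξ-id ≤-refl σ k x))

    ξ-comp-cong : ∀ σ k {p q r s} {x : Carrier (𝐀 p)}
                  (p≤q : p ≤ q) (q≤r : q ≤ r) (p≤s : p ≤ s) → r ≡ s →
                  _≡_ {A = ⨄ 𝐈 D} (r , app (ξ q≤r) σ k (app (ξ p≤q) σ k x))
                                  (s , app (ξ p≤s) σ k x)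
    ξ-comp-cong σ k p≤q q≤r p≤s refl = cong (_ ,_) (ξ-comp p≤q q≤r p≤s σ k _)

    sumBand-isLeftNormalBand : ∀ σ k → IsLeftNormalBand (sumBand 𝐈 D σ k)
    sumBand-isLeftNormalBand σ k = record
      { isBand = record
        { isSemigroup = record
          { isMagma = record
            { isEquivalence = isEquivalence
            ; ∙-cong        = cong₂ (sumBand 𝐈 D σ k)
            }
          -- The left side applies `ξ` twice, the right side once.
          ; assoc = λ (p , _) (q , _) (r , _) →
              ξ-comp-cong σ k (x≤x∨y p q) (x≤x∨y (p ∨ q) r) (x≤x∨y p (q ∨ r)) (∨-assoc p q r)
          }
        ; idem = λ x → sumBand-identityʳ σ k x x ≤-refl
        }
      -- The right operand enters only through its index.
      ; leftNormal = λ (p , _) (q , _) (r , _) →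
          ξ-cong σ k (x≤x∨y p (q ∨ r)) (x≤x∨y p (r ∨ q)) (cong (p ∨_) (∨-comm q r))
      }

    -- The right-hand side mentions neither `σ` nor `k`, which yields homotacticity.
    preorder⇔≤ : ∀ σ k (x y : ⨄ 𝐈 D) →
                 Preorder (sumBand 𝐈 D σ k) x y ⇔ (proj₁ x ≤ proj₁ y)
    preorder⇔≤ σ k (p , x) (q , y) = mk⇔
      (λ y⊙x≡y → subst (p ≤_) (cong proj₁ y⊙x≡y) (y≤x∨y q p))
      (sumBand-identityʳ σ k (q , y) (p , x))

    -- The equation is oriented so that it is literally `Fibre 𝐈 D (proj₁ x) y`.
    equiv⇔≡ : ∀ σ k x y → Equiv (sumBand 𝐈 D σ k) x y ⇔ (proj₁ y ≡ proj₁ x)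
    equiv⇔≡ σ k x y = mk⇔
      (λ (x≼y , y≼x) → antisym (to (preorder⇔≤ σ k y x) y≼x) (to (preorder⇔≤ σ k x y) x≼y))
      (λ q≡p → from (preorder⇔≤ σ k x y) (reflexive (sym q≡p))
             , from (preorder⇔≤ σ k y x) (reflexive q≡p))

    equiv-classes : ∀ σ k → ClassesAre (Equiv (sumBand 𝐈 D σ k)) (Fibre 𝐈 D)
    equiv-classes σ k =
        (λ x → proj₁ x , to (equiv⇔≡ σ k x _) , from (equiv⇔≡ σ k x _))
      , λ { _ (x , refl) → x , from (equiv⇔≡ σ k x _) , to (equiv⇔≡ σ k x _) }

    -- Successive images compose into one. Keeping `s` a variable lets the induction change the
    -- starting index while the target stays fixed.
    foldl′-sumBand : ∀ σ k {n} (xs : Vec (⨄ 𝐈 D) n) {p s} {x : Carrier (𝐀 p)} (p≤s : p ≤ s) →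
                     foldl′ _∨_ p (map proj₁ xs) ≡ s →
                     foldl′ (sumBand 𝐈 D σ k) (p , x) xs ≡ (s , app (ξ p≤s) σ k x)
    foldl′-sumBand σ k []             p≤s refl = cong (_ ,_) (sym (ξ-id p≤s σ k _))
    foldl′-sumBand σ k ((q , _) ∷ xs) {p} {s} p≤s eq =
      trans (foldl′-sumBand σ k xs p∨q≤s eq) (ξ-comp-cong σ k (x≤x∨y p q) p∨q≤s p≤s refl)
      where
      p∨q≤s : (p ∨ q) ≤ s
      p∨q≤s = subst ((p ∨ q) ≤_) eq (x≤foldl′-∨ (p ∨ q) (map proj₁ xs))

    module _ (bot : HasConstants τ → ∃ (Minimum _≤_)) where

      open Algebra (PłonkaSum 𝐈 D bot) using (⟦_⟧)

      -- Frees the operation from the particular inequality proofs, and the particular form of the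
      -- join, in its definition.
      PłonkaSum-image : ∀ σ xs {s} (xs≤s : ∀ k → proj₁ (lookup xs k) ≤ s) →
                        proj₁ (⟦ σ ⟧ xs) ≡ s →
                        ⟦ σ ⟧ xs ≡ (s , Algebra.⟦ 𝐀 s ⟧ σ (tabulate λ k →
                          app (ξ (xs≤s k)) σ (suc k) (proj₂ (lookup xs k))))
      PłonkaSum-image σ xs xs≤s refl = cong (λ v → _ , Algebra.⟦ 𝐀 _ ⟧ σ v)
        (tabulate-cong λ k → ξ-irrelevant _ (xs≤s k) σ (suc k) _)

      lookup≤PłonkaSum : ∀ σ xs k → proj₁ (lookup xs k) ≤ proj₁ (⟦ σ ⟧ xs)
      lookup≤PłonkaSum σ xs k =
        ≤-trans (reflexive (sym (lookup-map k proj₁ xs))) (lookup≤⋁ 𝐈 _ (map proj₁ xs) k)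

      sumBand-distrib : ∀ σ → arity τ σ > 0 → ∀ xs y →
                        sumBand 𝐈 D σ zero (⟦ σ ⟧ xs) y
                          ≡ ⟦ σ ⟧ (tabulate λ k → sumBand 𝐈 D σ (suc k) (lookup xs k) y)
      sumBand-distrib σ n>0 xs y@(q , _) = begin
        sumBand 𝐈 D σ zero (⟦ σ ⟧ xs) y
          -- The metamorphism law moves `ξ P≤s` from output coordinate `zero` to the argument
          -- coordinates `suc k`.
          ≡⟨ cong (s ,_) (hom (ξ P≤s) σ _) ⟩
        (s , A.⟦ σ ⟧ _)
          ≡⟨ cong (λ v → s , A.⟦ σ ⟧ v) (tabulate-cong argument) ⟩
        (s , A.⟦ σ ⟧ _)
          ≡⟨ PłonkaSum-image σ zs zs≤s (sym s≡) ⟨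
        ⟦ σ ⟧ zs ∎
        where
        open ≡-Reasoning

        zs : Vec (⨄ 𝐈 D) (arity τ σ)
        zs = tabulate λ k → sumBand 𝐈 D σ (suc k) (lookup xs k) y

        s : I
        s = proj₁ (⟦ σ ⟧ xs) ∨ q

        module A = Algebra (𝐀 s)

        P≤s : proj₁ (⟦ σ ⟧ xs) ≤ s
        P≤s = x≤x∨y _ q

        s≡ : s ≡ proj₁ (⟦ σ ⟧ zs)
        s≡ = ⋁-∨ _ (map proj₁ xs) (map proj₁ zs) q n>0 λ k →
          trans (lookup-map k proj₁ zs)
            (trans (cong proj₁ (lookup∘tabulate _ k)) (cong (_∨ q) (sym (lookup-map k proj₁ xs))))

        zs≤s : ∀ k → proj₁ (lookup zs k) ≤ s
        zs≤s k = ≤-trans (lookup≤PłonkaSum σ zs k) (reflexive (sym s≡))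

        xs≤s : ∀ k → proj₁ (lookup xs k) ≤ s
        xs≤s k = ≤-trans (lookup≤PłonkaSum σ xs k) P≤s

        -- A variable `z` in place of `lookup zs k` allows matching on `refl`, which rewrites index
        -- and element together.
        image : ∀ k z (z≤s : proj₁ z ≤ s) → z ≡ sumBand 𝐈 D σ (suc k) (lookup xs k) y →
                app (ξ (xs≤s k)) σ (suc k) (proj₂ (lookup xs k))
                  ≡ app (ξ z≤s) σ (suc k) (proj₂ z)
        image k z z≤s refl = sym (ξ-comp _ z≤s (xs≤s k) σ (suc k) _)

        argument : ∀ k → _ ≡ app (ξ (zs≤s k)) σ (suc k) (proj₂ (lookup zs k))
        -- Two factorizations of the direct map to `s`: through the index of `⟦ σ ⟧ xs`, and through
        -- the index of the `k`-th argument joined with `q`.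
        argument k = trans
          (trans (cong (app (ξ P≤s) σ (suc k)) (lookup∘tabulate _ k))
                 (ξ-comp _ P≤s (xs≤s k) σ (suc k) _))
          (image k (lookup zs k) (zs≤s k) (lookup∘tabulate _ k))

      -- Both sides are the image of `y` at the join of all indices involved; the elements of `xs`
      -- themselves do not matter.
      sumBand-absorb : ∀ σ xs y →
                       sumBand 𝐈 D σ zero y (⟦ σ ⟧ xs) ≡ foldl′ (sumBand 𝐈 D σ zero) y xs
      sumBand-absorb σ xs (q , _) = sym
        (foldl′-sumBand σ zero xs (x≤x∨y q _) (sym (∨-⋁ _ q (map proj₁ xs))))

      sumBand-isPartitionSystem : IsPartitionSystem (PłonkaSum 𝐈 D bot) (sumBand 𝐈 D)
      sumBand-isPartitionSystem = record
        { isLeftNormalBand = sumBand-isLeftNormalBand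
        ; homotactic       = λ σ k σ′ k′ x y →
            ⇔.trans (preorder⇔≤ σ k x y) (⇔.sym (preorder⇔≤ σ′ k′ x y))
        ; distrib          = sumBand-distrib
        ; absorb           = sumBand-absorb
        }

theorem4p6 :
  ∀ {o i ℓ a : Level} {τ : Signature o}
    {I : Set i} {_≤_ : Rel I ℓ} {_∨_ : Op₂ I}
    (𝐈 : IsJoinSemilattice _≡_ _≤_ _∨_)
    (bot : HasConstants τ → ∃ (Minimum _≤_))
    {𝐀 : I → Algebra τ a} (D : DirectedSystem 𝐈 𝐀) →
    IsPartitionSystem (PłonkaSum 𝐈 D bot) (sumBand 𝐈 D)
    × (∀ σ k → ClassesAre (Equiv (sumBand 𝐈 D σ k)) (Fibre 𝐈 D))
    × (∀ σ k {p q} (x : Carrier (𝐀 p)) (y : Carrier (𝐀 q)) →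
         Preorder (sumBand 𝐈 D σ k) (p , x) (q , y) ⇔ (p ≤ q))
    × (∀ σ k {p q} (p≤q : p ≤ q) (x : Carrier (𝐀 p)) (y : Carrier (𝐀 q)) →
         sumBand 𝐈 D σ k (p , x) (q , y)
           ≡ (q , app (DirectedSystem.ξ D p≤q) σ k x))
theorem4p6 𝐈 bot D =
    sumBand-isPartitionSystem 𝐈 D bot
  , equiv-classes 𝐈 D
  , (λ σ k x y → preorder⇔≤ 𝐈 D σ k (_ , x) (_ , y))
  , (λ σ k p≤q x y →
       sumBand-image 𝐈 D σ k (_ , x) (_ , y) p≤q (JoinSemilatticeProperties.x≤y⇒x∨y≈y (joinSemilattice 𝐈) p≤q))
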